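{- For each integer $\mu\geq 2$ there exists a large set with multiplicity LS$(3,4,10;\mu)$.
   Context: A Steiner system S$(t,k,n)$ is a pair $(Q,B)$ where $Q$ is an $n$-set and $B$ is a collection of $k$-subsets (blocks) of $Q$ such that every $t$-subset of $Q$ is contained in exactly one block. A large set with multiplicity $\mu$, LS$(t,k,n;\mu)$, is a family (the same system may occur more than once) of Steiner systems S$(t,k,n)$ on a common $n$-set $Q$ such that every $k$-subset of $Q$ is a block of exactly $\mu$ of the systems. -}

module Defs where

open import Data.Bool.Properties using (_≟_)
open import Data.Fin.Subset using (Subset; ∣_∣; _⊆_)
open import Data.List.Base using (List; length; filter)
open import Data.List.Relation.Unary.All using (All)
open import Data.List.Relation.Unary.Unique.Propositional using (Unique)
import Data.List.Membership.DecPropositional as DecMembership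
open import Data.Nat.Base using (ℕ)
open import Data.Product using (_×_; ∃!)
open import Data.Vec.Properties using (≡-dec)
open import Relation.Binary.Definitions using (DecidableEquality)
open import Relation.Binary.PropositionalEquality using (_≡_)

_≟ˢ_ : ∀ {n} → DecidableEquality (Subset n)
_≟ˢ_ = ≡-dec _≟_

open module SubsetMembership {n} = DecMembership (_≟ˢ_ {n}) using (_∈_; _∈?_)

-- The n-set Q of points is Fin n.  A set of blocks is a repetition-free
-- list of subsets, whose order plays no role.
record IsSteinerSystem (t k n : ℕ) (B : List (Subset n)) : Set where
  field
    unique     : Unique B
    block-size : All (λ b → ∣ b ∣ ≡ k) B
    covering   : ∀ (T : Subset n) → ∣ T ∣ ≡ t →
                 ∃! _≡_ (λ b → b ∈ B × T ⊆ b)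

-- The number of entries of the family having K as a block; repeated
-- systems are counted with repetition.
multiplicity : ∀ {n} → List (List (Subset n)) → Subset n → ℕ
multiplicity F K = length (filter (K ∈?_) F)

record IsLargeSet (t k n μ : ℕ) (F : List (List (Subset n))) : Set where
  field
    steiner     : All (IsSteinerSystem t k n) F
    equidistrib : ∀ (K : Subset n) → ∣ K ∣ ≡ k → multiplicity F K ≡ μ

record LargeSet (t k n μ : ℕ) : Set where
  field
    systems    : List (List (Subset n))
    isLargeSet : IsLargeSet t k n μ systems

{-# OPTIONS --safe #-}
module Submission where

-- Multiplicities add when families are concatenated, so it suffices to
-- exhibit large sets with multiplicities 2 and 3.  Both are unions of orbits,
-- under a cyclic group of order 6 respectively 7, of relabelled copies of the
-- cyclic S(3,4,10), found by computer search with these groups prescribed.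

open import Defs
open SubsetMembership using (_∈_; _∈?_)
open import Data.Fin using (Fin)
open import Data.Fin.Subset using (Subset; ∣_∣; ⁅_⁆; ⋃)
open import Data.Fin.Subset.Properties using (anySubset?; _⊆?_)
open import Data.List using (List; []; _∷_; _++_; concatMap; filter; iterate; length; map)
open import Data.List.Membership.Propositional using (find; lose)
open import Data.List.Properties using (filter-++; length-++)
import Data.List.Relation.Unary.All as All
open import Data.List.Relation.Unary.All.Properties using (++⁺)
import Data.List.Relation.Unary.Any as Any
import Data.List.Relation.Unary.Unique.DecPropositional as DecUnique
open import Data.Nat using (ℕ; suc; _+_; _≥_; z≤n; s≤s; _≟_)
open import Data.Nat.DivMod using (_mod_)
open import Data.Product using (_×_; _,_; ∃!)
open import Data.Vec using (Vec; lookup; []; _∷_)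
import Data.Vec as Vec
open import Function using (_∘_)
open import Level using (Level)
open import Relation.Binary.PropositionalEquality using (_≡_; cong; cong₂; module ≡-Reasoning)
open import Relation.Nullary using (Dec; ¬?)
open import Relation.Nullary.Decidable using (decidable-stable; from-yes; map′; _×-dec_; _→-dec_)
open import Relation.Unary using (Pred; Decidable)

private
  variable
    p : Level
    n : ℕ

-- A counterexample is searched for; since `P` is decidable, a failed search yields `P T` itself and
-- not only its double negation.
allSubsets? : {P : Pred (Subset n) p} → Decidable P → Dec (∀ T → P T)
allSubsets? P? = map′
  (λ ∄¬P T → decidable-stable (P? T) (λ ¬PT → ∄¬P (T , ¬PT)))
  (λ ∀P (T , ¬PT) → ¬PT (∀P T))
  (¬? (anySubset? (¬? ∘ P?)))

-- The witness and all its competitors lie in `B`, so existence and uniqueness both reduce to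
-- searches through that list.
∃!∈? : {P : Pred (Subset n) p} → Decidable P → (B : List (Subset n)) →
       Dec (∃! _≡_ (λ b → b ∈ B × P b))
∃!∈? {P = P} P? B = map′
  (λ any → let b , b∈B , Pb , only-b = find {P = λ b → P b × All.All (λ c → P c → b ≡ c) B} any in
    b , (b∈B , Pb) , λ (c∈B , Pc) → All.lookup only-b c∈B Pc)
  (λ (b , (b∈B , Pb) , b-unique) →
    lose b∈B (Pb , All.tabulate (λ c∈B Pc → b-unique (c∈B , Pc))))
  (Any.any? (λ b → P? b ×-dec All.all? (λ c → P? c →-dec b ≟ˢ c) B) B)

isSteinerSystem? : ∀ t k → Decidable (IsSteinerSystem t k n)
isSteinerSystem? t k B = map′
  (λ (u , s , c) → record { unique = u ; block-size = s ; covering = c })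
  (λ S → let open IsSteinerSystem S in unique , block-size , covering)
  (DecUnique.unique? _≟ˢ_ B
    ×-dec All.all? (λ b → ∣ b ∣ ≟ k) B
    ×-dec allSubsets? (λ T → ∣ T ∣ ≟ t →-dec ∃!∈? (T ⊆?_) B))

multiplicity-++ : (F G : List (List (Subset n))) (K : Subset n) →
                  multiplicity (F ++ G) K ≡ multiplicity F K + multiplicity G K
multiplicity-++ F G K = begin
  length (filter (K ∈?_) (F ++ G))                  ≡⟨ cong length (filter-++ (K ∈?_) F G) ⟩
  length (filter (K ∈?_) F ++ filter (K ∈?_) G)     ≡⟨ length-++ (filter (K ∈?_) F) ⟩
  multiplicity F K + multiplicity G K               ∎
  where open ≡-Reasoning

infixl 6 _⊕_

_⊕_ : ∀ {t k μ ν} → LargeSet t k n μ → LargeSet t k n ν → LargeSet t k n (μ + ν)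
L ⊕ M = record
  { systems    = L.systems ++ M.systems
  ; isLargeSet = record
    { steiner     = ++⁺ L.steiner M.steiner
    ; equidistrib = λ K ∣K∣≡k → begin
        multiplicity (L.systems ++ M.systems) K              ≡⟨ multiplicity-++ L.systems M.systems K ⟩
        multiplicity L.systems K + multiplicity M.systems K  ≡⟨ cong₂ _+_ (L.equidistrib K ∣K∣≡k) (M.equidistrib K ∣K∣≡k) ⟩
        _                                                    ∎
    }
  }
  where
  open ≡-Reasoning
  module L where
    open LargeSet L public
    open IsLargeSet isLargeSet public
  module M where
    open LargeSet M public
    open IsLargeSet isLargeSet public

-- π is given in one-line notation, and the result is the preimage of b under π.
relabel : Vec (Fin n) n → Subset n → Subset n
relabel π b = Vec.map (lookup b) π

points : ∀ {k} → Vec ℕ k → Vec (Fin 10) k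
points = Vec.map (_mod 10)

-- Three base blocks are developed under translation modulo 10. Each translation orbit has full
-- length 10, giving the 30 = C(10,3)/4 blocks of an S(3,4,10).
cyclicS[3,4,10] : List (Subset 10)
cyclicS[3,4,10] = concatMap
  (λ b → iterate (relabel (points (1 ∷ 2 ∷ 3 ∷ 4 ∷ 5 ∷ 6 ∷ 7 ∷ 8 ∷ 9 ∷ 0 ∷ []))) b 10)
  (map (λ b → ⋃ (map ⁅_⁆ (Vec.toList (points b))))
    ( (0 ∷ 1 ∷ 3 ∷ 4 ∷ [])
    ∷ (0 ∷ 1 ∷ 2 ∷ 6 ∷ [])
    ∷ (0 ∷ 2 ∷ 4 ∷ 7 ∷ [])
    ∷ []))

-- With `m` the order of `σ`, the list runs once through the cyclic group generated by `σ`, acting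
-- on the copy relabelled by `π`; repeated systems are kept.
orbit : Vec ℕ 10 → ℕ → Vec ℕ 10 → List (List (Subset 10))
orbit σ m π = iterate (map (relabel (points σ))) (map (relabel (points π)) cyclicS[3,4,10]) m

-- σ is an automorphism of the cyclic system, whose orbit is thus a single system,
-- here repeated twice.
largeSet₂ : LargeSet 3 4 10 2
largeSet₂ = record
  { systems    = family
  ; isLargeSet = record
    { steiner     = from-yes (All.all? (isSteinerSystem? 3 4) family)
    ; equidistrib = from-yes (allSubsets? (λ K → ∣ K ∣ ≟ 4 →-dec multiplicity family K ≟ 2))
    }
  }
  where
  -- The cycles are (0)(1 2 3 5 4 8)(6 9 7), so the order is 6.
  σ : Vec ℕ 10
  σ = 0 ∷ 2 ∷ 3 ∷ 5 ∷ 8 ∷ 4 ∷ 9 ∷ 6 ∷ 1 ∷ 7 ∷ []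

  -- Counting blocks forces 2 · 210 / 30 = 14 systems, here 2 + 2 · 6.
  family : List (List (Subset 10))
  family = cyclicS[3,4,10] ∷ cyclicS[3,4,10] ∷ concatMap (orbit σ 6)
    ( (0 ∷ 1 ∷ 2 ∷ 6 ∷ 9 ∷ 3 ∷ 4 ∷ 5 ∷ 8 ∷ 7 ∷ [])
    ∷ (0 ∷ 1 ∷ 2 ∷ 3 ∷ 9 ∷ 4 ∷ 7 ∷ 5 ∷ 8 ∷ 6 ∷ [])
    ∷ [])

largeSet₃ : LargeSet 3 4 10 3
largeSet₃ = record
  { systems    = family
  ; isLargeSet = record
    { steiner     = from-yes (All.all? (isSteinerSystem? 3 4) family)
    ; equidistrib = from-yes (allSubsets? (λ K → ∣ K ∣ ≟ 4 →-dec multiplicity family K ≟ 3))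
    }
  }
  where
  σ : Vec ℕ 10
  σ = 1 ∷ 2 ∷ 3 ∷ 4 ∷ 5 ∷ 6 ∷ 0 ∷ 7 ∷ 8 ∷ 9 ∷ []

  -- Here `σ` is a 7-cycle fixing 7, 8 and 9. The forced number of systems is 3 · 210 / 30 = 21,
  -- that is, three orbits of length 7.
  family : List (List (Subset 10))
  family = concatMap (orbit σ 7)
    ( (1 ∷ 0 ∷ 2 ∷ 3 ∷ 4 ∷ 5 ∷ 8 ∷ 6 ∷ 9 ∷ 7 ∷ [])
    ∷ (0 ∷ 1 ∷ 3 ∷ 2 ∷ 4 ∷ 9 ∷ 5 ∷ 8 ∷ 6 ∷ 7 ∷ [])
    ∷ (0 ∷ 1 ∷ 2 ∷ 6 ∷ 3 ∷ 7 ∷ 4 ∷ 5 ∷ 9 ∷ 8 ∷ [])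
    ∷ [])

theorem16 : ∀ (μ : ℕ) → μ ≥ 2 → LargeSet 3 4 10 μ
theorem16 1                           (s≤s ())
theorem16 2                           _ = largeSet₂
theorem16 3                           _ = largeSet₃
-- The multiplicity sought is at least 4, so splitting off 2 leaves a `μ` that is still at least 2;
-- the recursion ends at 2 or 3 according to parity.
theorem16 (suc (suc μ@(suc (suc _)))) _ = largeSet₂ ⊕ theorem16 μ (s≤s (s≤s z≤n))
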